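{- It is undecidable whether the trace semantics induced by a primitive recursive stateful SOS specification is compositional; that is, there is no algorithm which, given a primitive recursive stateful SOS specification $\mathcal L$, decides whether its trace semantics $\llbracket-\rrbracket_{\mathcal L}$ is compositional. Likewise, it is undecidable whether the termination semantics induced by a primitive recursive stateful SOS specification is compositional.
   Context: **Signature and terms.** $\Sigma$ is an algebraic signature (operation symbols $\mathsf f$ with arities in $\mathbb N$), $S$ is a countable set of states, $\Sigma^\star X$ is the set of $\Sigma$-terms with variables from $X$, and $\mu\Sigma=\Sigma^\star\emptyset$ is the set of closed terms (programs). $\mathcal V=\{x_1,x_2,\dots\}\cup\{y_1,y_2,\dots\}$ is a countably infinite set of variables. $1=\{*\}$. **Specifications.** A progressing literal is $s,p\to s',q$ and a terminating literal is $s,p\downarrow s'$, with $s,s'\in S$, $p,q\in\Sigma^\star\mathcal V$ (input $s$, source $p$, output $s'$, target $q$). A stateful SOS rule for an $n$-ary $\mathsf f$ is an expression $l_1\dots l_n/L$ of literals (premisses $l_j$, conclusion $L$) with the same input $s$, such that the source of $l_j$ is $x_j$, its target is $y_j$ if it is progressing, the source of $L$ is $\mathsf f(x_1,\dots,x_n)$, and if $L$ is progressing all variables of its target appear as source or target of some premiss. The rule is progressing/terminating if $L$ is. Its trigger is $(s,(s_1',\mathtt c_1),\dots,(s_n',\mathtt c_n))$, where $s_j'$ is the output of $l_j$ and $\mathtt c_j=\mathtt{pr}$ or $\mathtt{te}$ according to whether $l_j$ is progressing or terminating. A stateful SOS specification is a set of rules containing, for each $n$-ary $\mathsf f$ and each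 $(s,(s_1',\mathtt c_1),\dots,(s_n',\mathtt c_n))$ with $s,s_j'\in S$, $\mathtt c_j\in\{\mathtt{pr},\mathtt{te}\}$, exactly one rule for $\mathsf f$ with that trigger. **Primitive recursive specifications.** Suitable encodings of states and terms as finite strings are fixed. A specification $\mathcal L$ is regarded as a total function assigning to a given operation symbol, input state and list of premisses the target of the conclusion (or the information that the conclusion is terminating) and the output state of the respective rule. $\mathcal L$ is primitive recursive if this function is primitive recursive; such an $\mathcal L$ is given as input to an algorithm by a finite (primitive recursive) description of this function. **Transition function.** $\gamma_0\colon S\times\mu\Sigma\to S\times(\mu\Sigma+1)$ is defined by induction on programs: for $p=\mathsf f(t_1,\dots,t_n)$ let $(s_j',w_j)=\gamma_0(s,t_j)$, and take the unique rule for $\mathsf f$ with trigger $(s,(s_1',\mathtt c_1),\dots,(s_n',\mathtt c_n))$, where $\mathtt c_j=\mathtt{te}$ if $w_j=*$ and $\mathtt c_j=\mathtt{pr}$ otherwise; with $s'$ the output of its conclusion, $\gamma_0(s,p)=(s',*)$ if the rule is terminating, and otherwise $\gamma_0(s,p)=(s',t')$, where $t'$ is the target of the conclusion with $x_j$ replaced by $t_j$ and $y_j$ by $w_j$. Write $s,p\to s',p'$ if $\gamma_0(s,p)=(s',p')$, and $s,p\downarrow s'$ if $\gamma_0(s,p)=(s',*)$. **Trace semantics.** $\llbracket-\rrbracket_{\mathcal L}\colon\mu\Sigma\to(S^{+}+S^{\omega})^S$ (with $S^+$ the nonempty finite and $S^\omega$ the infinite sequences over $S$) sends $p$ and $s$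 to the possibly terminating sequence of states $s_1s_2s_3\cdots$ computed by $p$ on input $s$: $s,p\to s_1,p_1\to s_2,p_2\to\cdots$; if some step is terminating, $s_{k-1},p_{k-1}\downarrow s_k$, the sequence is $s_1\cdots s_k$. **Termination semantics.** The map $\mu\Sigma\to(S+\{\bot\})^S$ sending $p$ and $s$ to the last state of $\llbracket p\rrbracket_{\mathcal L}(s)$ if this sequence is finite, and to $\bot$ otherwise. **Compositionality.** A semantics $\phi\colon\mu\Sigma\to D$ is compositional if for every $n$-ary $\mathsf f\in\Sigma$ and all $p_i,q_i\in\mu\Sigma$, $\phi(p_i)=\phi(q_i)$ for $i=1,\dots,n$ implies $\phi(\mathsf f(p_1,\dots,p_n))=\phi(\mathsf f(q_1,\dots,q_n))$. -}

module Defs where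

open import Data.Bool using (Bool; true; false)
open import Data.Empty using (⊥)
open import Data.Fin using (Fin; zero; suc; toℕ)
open import Data.Maybe using (Maybe; just; nothing)
open import Data.Nat using (ℕ; zero; suc; _+_; _*_; _^_; _<_)
open import Data.Product using (Σ; ∃; _×_; _,_; proj₁; proj₂)
open import Data.Vec using (Vec; []; _∷_; lookup; map)
open import Function.Bundles using (_⇔_; _↣_; Injection)
open import Function.Properties.Equivalence using (⇔-isEquivalence)
open import Level using (Level; 0ℓ) renaming (suc to lsuc)
open import Relation.Binary.Bundles using (Setoid)
open import Relation.Binary.PropositionalEquality using (_≡_; refl; sym; trans)
open import Relation.Binary.Structures using (IsEquivalence)
open import Relation.Nullary using (Dec; does; ¬_)

record Signature : Set₁ where
  field
    Op    : Set
    arity : Op → ℕ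

open Signature public

data Term (Sg : Signature) (V : Set) : Set where
  var : V → Term Sg V
  op  : (f : Op Sg) → Vec (Term Sg V) (arity Sg f) → Term Sg V

Program : Signature → Set
Program Sg = Term Sg ⊥

module _ {Sg : Signature} {V W : Set} (σ : V → Term Sg W) where

  substitute  : Term Sg V → Term Sg W
  substitute* : ∀ {n} → Vec (Term Sg V) n → Vec (Term Sg W) n

  substitute (var v)   = σ v
  substitute (op f ts) = op f (substitute* ts)

  substitute* []       = []
  substitute* (t ∷ ts) = substitute t ∷ substitute* ts

data Mode : Set where
  pr te : Mode

-- The outputs and modes of the premisses of a rule.  Together with the input
-- state they determine the premisses: (s′ , pr) in position j stands for
-- s,xⱼ → s′,yⱼ and (s′ , te) for s,xⱼ ↓ s′.
Premisses : Set → ℕ → Set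
Premisses S n = Vec (S × Mode) n

-- The variables that occur as source or target of some premiss: all xⱼ, and
-- yⱼ exactly when the j-th premiss is progressing.
data Var {S : Set} {n : ℕ} (ls : Premisses S n) : Set where
  x : Fin n → Var ls
  y : (j : Fin n) → proj₂ (lookup ls j) ≡ pr → Var ls

-- Output and target of the conclusion; a terminating conclusion has no target.
Conclusion : (Sg : Signature) (S : Set) {n : ℕ} → Premisses S n → Set
Conclusion Sg S ls = S × Maybe (Term Sg (Var ls))

-- A specification has exactly one rule for each operation symbol and each
-- trigger, that is, it is a function from these to conclusions.
Specification : Signature → Set → Set
Specification Sg S =
  (f : Op Sg) → S → (ls : Premisses S (arity Sg f)) → Conclusion Sg S ls

module _ {Sg : Signature} {S : Set} where

  mode : Maybe (Program Sg) → Mode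
  mode (just _) = pr
  mode nothing  = te

  premisses : ∀ {n} → Vec (S × Maybe (Program Sg)) n → Premisses S n
  premisses []             = []
  premisses ((s , w) ∷ rs) = (s , mode w) ∷ premisses rs

  successor : ∀ {n} (rs : Vec (S × Maybe (Program Sg)) n) (j : Fin n) →
              proj₂ (lookup (premisses rs) j) ≡ pr → Program Sg
  successor ((_ , just w)  ∷ _)  zero    _  = w
  successor ((_ , nothing) ∷ _)  zero    ()
  successor (_             ∷ rs) (suc j) e  = successor rs j e

  -- xⱼ ↦ tⱼ and yⱼ ↦ wⱼ
  instantiate : ∀ {n} → Vec (Program Sg) n →
                (rs : Vec (S × Maybe (Program Sg)) n) →
                Var (premisses rs) → Program Sg
  instantiate ts rs (x j)   = lookup ts j
  instantiate ts rs (y j e) = successor rs j e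

  conclude : ∀ {n} → Vec (Program Sg) n →
             (rs : Vec (S × Maybe (Program Sg)) n) →
             Conclusion Sg S (premisses rs) → S × Maybe (Program Sg)
  conclude ts rs (s′ , nothing) = s′ , nothing
  conclude ts rs (s′ , just t)  = s′ , just (substitute (instantiate ts rs) t)

  module _ (L : Specification Sg S) where

    γ₀  : S → Program Sg → S × Maybe (Program Sg)
    γ₀* : ∀ {n} → S → Vec (Program Sg) n → Vec (S × Maybe (Program Sg)) n

    γ₀ s (op f ts) = conclude ts rs (L f s (premisses rs))
      where rs = γ₀* s ts

    γ₀* s []       = []
    γ₀* s (t ∷ ts) = γ₀ s t ∷ γ₀* s ts

-- A possibly terminating sequence s₁s₂s₃⋯ is given by the function sending k
-- to just sₖ₊₁ if this state exists and to nothing otherwise.  The sum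
-- S⁺ + S^ω itself cannot be used as a codomain constructively, since the
-- semantics would have to decide termination.  Functions not of this form are
-- not in the image of the trace semantics and hence irrelevant.
PartialSeq : Set → Set
PartialSeq S = ℕ → Maybe S

-- t is the last state of a finite sequence.
Last : {S : Set} → PartialSeq S → S → Set
Last w t = ∃ λ k → w k ≡ just t × w (suc k) ≡ nothing

TraceDomain : Set → Setoid 0ℓ 0ℓ
TraceDomain S = record
  { Carrier       = S → PartialSeq S
  ; _≈_           = λ φ ψ → ∀ s k → φ s k ≡ ψ s k
  ; isEquivalence = record
    { refl  = λ _ _ → refl
    ; sym   = λ p s k → sym (p s k)
    ; trans = λ p q s k → trans (p s k) (q s k)
    }
  }

-- An element d of S + {⊥} is represented by the predicate "d is the state t";
-- ⊥ is the empty predicate.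
TerminationDomain : Set → Setoid (lsuc 0ℓ) 0ℓ
TerminationDomain S = record
  { Carrier       = S → S → Set
  ; _≈_           = λ φ ψ → ∀ s t → φ s t ⇔ ψ s t
  ; isEquivalence = record
    { refl  = λ _ _ → Eq.refl
    ; sym   = λ p s t → Eq.sym (p s t)
    ; trans = λ p q s t → Eq.trans (p s t) (q s t)
    }
  }
  where module Eq = IsEquivalence (⇔-isEquivalence {0ℓ})

module _ {Sg : Signature} {S : Set} (L : Specification Sg S) where

  trace     : Program Sg → S → PartialSeq S
  traceFrom : S × Maybe (Program Sg) → PartialSeq S

  trace p s = traceFrom (γ₀ L s p)

  traceFrom (s , w)       zero    = just s
  traceFrom (s , nothing) (suc k) = nothing
  traceFrom (s , just p)  (suc k) = trace p s k

  termination : Program Sg → S → S → Set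
  termination p s t = Last (trace p s) t

Compositional : {Sg : Signature} {c ℓ : Level} (D : Setoid c ℓ) →
                (Program Sg → Setoid.Carrier D) → Set ℓ
Compositional {Sg} D φ =
  (f : Op Sg) (ps qs : Vec (Program Sg) (arity Sg f)) →
  (∀ i → φ (lookup ps i) ≈ φ (lookup qs i)) → φ (op f ps) ≈ φ (op f qs)
  where open Setoid D using (_≈_)

TraceCompositional : {Sg : Signature} {S : Set} → Specification Sg S → Set
TraceCompositional {S = S} L = Compositional (TraceDomain S) (trace L)

TerminationCompositional : {Sg : Signature} {S : Set} →
                           Specification Sg S → Set
TerminationCompositional {S = S} L =
  Compositional (TerminationDomain S) (termination L)

data PR : ℕ → Set where
  zer  : ∀ {n} → PR n
  succ : PR 1
  proj : ∀ {n} → Fin n → PR n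
  comp : ∀ {m n} → PR m → Vec (PR n) m → PR n
  rec  : ∀ {n} → PR n → PR (2 + n) → PR (suc n)

eval  : ∀ {n} → PR n → Vec ℕ n → ℕ
eval* : ∀ {m n} → Vec (PR n) m → Vec ℕ n → Vec ℕ m

eval zer         xs           = 0
eval succ        (k ∷ [])     = suc k
eval (proj i)    xs           = lookup xs i
eval (comp f gs) xs           = eval f (eval* gs xs)
eval (rec f g)   (zero ∷ xs)  = eval f xs
eval (rec f g)   (suc k ∷ xs) = eval g (k ∷ eval (rec f g) (k ∷ xs) ∷ xs)

eval* []       xs = []
eval* (g ∷ gs) xs = eval g xs ∷ eval* gs xs

-- General recursive functions serve as the model of computation.
data Rec : ℕ → Set where
  zer  : ∀ {n} → Rec n
  succ : Rec 1
  proj : ∀ {n} → Fin n → Rec n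
  comp : ∀ {m n} → Rec m → Vec (Rec n) m → Rec n
  rec  : ∀ {n} → Rec n → Rec (2 + n) → Rec (suc n)
  min  : ∀ {n} → Rec (suc n) → Rec n

infix 4 _[_]⇓_ _[_]⇓*_

data _[_]⇓_  : ∀ {n} → Rec n → Vec ℕ n → ℕ → Set
data _[_]⇓*_ : ∀ {m n} → Vec (Rec n) m → Vec ℕ n → Vec ℕ m → Set

data _[_]⇓_ where
  ⇓zer  : ∀ {n} {xs : Vec ℕ n} → zer [ xs ]⇓ 0
  ⇓succ : ∀ {k} → succ [ k ∷ [] ]⇓ suc k
  ⇓proj : ∀ {n} {xs : Vec ℕ n} {i} → proj i [ xs ]⇓ lookup xs i
  ⇓comp : ∀ {m n} {f : Rec m} {gs : Vec (Rec n) m} {xs ys v} →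
          gs [ xs ]⇓* ys → f [ ys ]⇓ v → comp f gs [ xs ]⇓ v
  ⇓rec₀ : ∀ {n} {f : Rec n} {g xs v} →
          f [ xs ]⇓ v → rec f g [ 0 ∷ xs ]⇓ v
  ⇓recₛ : ∀ {n} {f : Rec n} {g xs k u v} →
          rec f g [ k ∷ xs ]⇓ u → g [ k ∷ u ∷ xs ]⇓ v →
          rec f g [ suc k ∷ xs ]⇓ v
  ⇓min  : ∀ {n} {f : Rec (suc n)} {xs k} →
          (∀ i → i < k → ∃ λ v → f [ i ∷ xs ]⇓ suc v) →
          f [ k ∷ xs ]⇓ 0 → min f [ xs ]⇓ k

data _[_]⇓*_ where
  []  : ∀ {n} {xs : Vec ℕ n} → [] [ xs ]⇓* []
  _∷_ : ∀ {m n} {g : Rec n} {gs : Vec (Rec n) m} {xs v vs} →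
        g [ xs ]⇓ v → gs [ xs ]⇓* vs → (g ∷ gs) [ xs ]⇓* (v ∷ vs)

-- A bijection from ℕ × ℕ to the positive numbers, so that 0 is free to encode
-- the empty list and the absent target of a terminating conclusion.
⟨_,_⟩ : ℕ → ℕ → ℕ
⟨ a , b ⟩ = 2 ^ a * (1 + 2 * b)

list : ∀ {n} → Vec ℕ n → ℕ
list []       = 0
list (a ∷ as) = ⟨ a , list as ⟩

-- Gödel numbering of primitive recursive functions of a known arity.
⌜_⌝  : ∀ {n} → PR n → ℕ
⌜_⌝* : ∀ {m n} → Vec (PR n) m → ℕ

⌜ zer ⌝       = ⟨ 0 , 0 ⟩
⌜ succ ⌝      = ⟨ 1 , 0 ⟩
⌜ proj i ⌝    = ⟨ 2 , toℕ i ⟩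
⌜ comp f gs ⌝ = ⟨ 3 , ⟨ ⌜ gs ⌝* , ⌜ f ⌝ ⟩ ⟩
⌜ rec f g ⌝   = ⟨ 4 , ⟨ ⌜ f ⌝ , ⌜ g ⌝ ⟩ ⟩

⌜ [] ⌝*     = 0
⌜ g ∷ gs ⌝* = ⟨ ⌜ g ⌝ , ⌜ gs ⌝* ⟩

module Encoding {Sg : Signature} {S : Set} (encOp : Op Sg ↣ ℕ) (encS : S ↣ ℕ)
  where

  ⌜_⌝ₒ : Op Sg → ℕ
  ⌜_⌝ₒ = Injection.to encOp

  ⌜_⌝ₛ : S → ℕ
  ⌜_⌝ₛ = Injection.to encS

  modeCode : Mode → ℕ
  modeCode pr = 1
  modeCode te = 0

  premissesCode : ∀ {n} → Premisses S n → ℕ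
  premissesCode ls = list (map (λ l → ⟨ modeCode (proj₂ l) , ⌜ proj₁ l ⌝ₛ ⟩) ls)

  varCode : ∀ {n} {ls : Premisses S n} → Var ls → ℕ
  varCode (x j)   = ⟨ 0 , toℕ j ⟩
  varCode (y j _) = ⟨ 1 , toℕ j ⟩

  module _ {n : ℕ} {ls : Premisses S n} where

    termCode  : Term Sg (Var ls) → ℕ
    termCode* : ∀ {m} → Vec (Term Sg (Var ls)) m → ℕ

    termCode (var v)   = varCode v
    termCode (op f ts) = ⟨ 2 , ⟨ ⌜ f ⌝ₒ , termCode* ts ⟩ ⟩

    termCode* []       = 0
    termCode* (t ∷ ts) = ⟨ termCode t , termCode* ts ⟩

    conclusionCode : Conclusion Sg S ls → ℕ
    conclusionCode (s′ , nothing) = ⟨ ⌜ s′ ⌝ₛ , 0 ⟩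
    conclusionCode (s′ , just t)  = ⟨ ⌜ s′ ⌝ₛ , termCode t ⟩

-- Besides the function giving the rules, a description contains the set of
-- codes of operation symbols, their arities and the set of codes of states;
-- otherwise the algorithm's input would not determine the specification.
record Description : Set where
  field
    isOp    : PR 1
    ar      : PR 1
    isState : PR 1
    rule    : PR 3

descriptionCode : Description → ℕ
descriptionCode d =
  list (⌜ isOp ⌝ ∷ ⌜ ar ⌝ ∷ ⌜ isState ⌝ ∷ ⌜ rule ⌝ ∷ [])
  where open Description d

-- The function computed by rule is only constrained on codes of actual
-- operation symbols, states and lists of premisses.
record Describes (d : Description) {Sg : Signature} {S : Set}
                 (encOp : Op Sg ↣ ℕ) (encS : S ↣ ℕ)
                 (L : Specification Sg S) : Set where
  open Description d
  open Encoding {Sg} encOp encS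
  field
    isOp-correct    : ∀ c → eval isOp (c ∷ []) ≡ 1 ⇔ (∃ λ f → ⌜ f ⌝ₒ ≡ c)
    ar-correct      : ∀ f → eval ar (⌜ f ⌝ₒ ∷ []) ≡ arity Sg f
    isState-correct : ∀ c → eval isState (c ∷ []) ≡ 1 ⇔ (∃ λ s → ⌜ s ⌝ₛ ≡ c)
    rule-correct    : ∀ f s ls →
      eval rule (⌜ f ⌝ₒ ∷ ⌜ s ⌝ₛ ∷ premissesCode ls ∷ [])
        ≡ conclusionCode (L f s ls)

record PrimitiveRecursiveSpecification : Set₁ where
  field
    signature     : Signature
    State         : Set
    encOp         : Op signature ↣ ℕ
    encState      : State ↣ ℕ
    specification : Specification signature State
    description   : Description
    describes     : Describes description encOp encState specification

open PrimitiveRecursiveSpecification public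

boolCode : Bool → ℕ
boolCode true  = 1
boolCode false = 0

-- Nothing is required of e on inputs that do not describe a specification.
_Decides_ : Rec 1 →
            (∀ {Sg : Signature} {S : Set} → Specification Sg S → Set) → Set₁
e Decides P = (L : PrimitiveRecursiveSpecification) →
  Σ (Dec (P (specification L))) λ P? →
    e [ descriptionCode (description L) ∷ [] ]⇓ boolCode (does P?)

Undecidable : (∀ {Sg : Signature} {S : Set} → Specification Sg S → Set) → Set₁
Undecidable P = ¬ (∃ λ e → e Decides P)

{-# OPTIONS --safe #-}
-- Suppose e decides compositionality.  By the recursion theorem there is a
-- specification over the states ℕ whose rules know the code c of its own
-- description.  Its program probe terminates with output s in state s if
-- computing e on c with all searches bounded by s succeeds with value 1, and
-- with output 0 otherwise; halt always terminates with output 0.  Both agree in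
-- state 0, so toHalt and toProbe, which pass to state 0 before becoming halt and
-- probe, have the same semantics.  The operation restore exposes their
-- successors to the original state, hence the specification is compositional
-- exactly when probe always outputs 0, that is, when e does not answer 1 on c.
module Submission where

open import Defs
open import Data.Fin using (Fin; zero; suc; toℕ)
open import Data.Fin.Properties using (toℕ-injective)
open import Data.Maybe using (Maybe; just; nothing)
open import Data.Maybe.Properties using (just-injective)
open import Data.Nat
  using (ℕ; zero; suc; pred; _+_; _*_; _^_; _∸_; _⊔_; _≤_; _<_; z≤n)
open import Data.Nat.Properties
  using ( +-identityʳ; +-suc; *-identityʳ; m≤m⊔n; m≤n⊔m; ≤-trans; ≤-refl; n≤1+n; <⇒≤
        ; n<1+n; m<n⇒m<1+n; m≤n⇒m<n∨m≡n; m∸n+n≡m; m<1+n⇒m<n∨m≡n )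
open import Data.Product using (Σ; ∃; _×_; _,_; proj₁; proj₂)
open import Data.Sum using (_⊎_; inj₁; inj₂)
open import Data.Vec using (Vec; []; _∷_; lookup; map; tabulate; replicate)
open import Data.Vec.Properties using (lookup-map; lookup-replicate)
open import Function using (_∘_; id)
open import Function.Bundles using (_⇔_; _↣_; mk⇔; mk↣; Equivalence)
import Function.Properties.Equivalence as ⇔
open import Relation.Binary.PropositionalEquality
  using (_≡_; _≢_; refl; sym; trans; cong; cong₂; subst; module ≡-Reasoning)
open import Relation.Nullary using (Dec; does; yes; no; ¬_)

-- Primitive recursive functions

-- Re-indexing of arguments along `ρ`; a shift `ρ` drops leading arguments.
projections : ∀ {m n} → (Fin m → Fin n) → Vec (PR n) m
projections ρ = tabulate (proj ∘ ρ)

eval*-projections : ∀ {m n} (ρ : Fin m → Fin n) {xs : Vec ℕ n} {ys : Vec ℕ m} →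
                    (∀ i → lookup xs (ρ i) ≡ lookup ys i) →
                    eval* (projections ρ) xs ≡ ys
eval*-projections {zero}  ρ {ys = []}     eq = refl
eval*-projections {suc m} ρ {ys = b ∷ ys} eq =
  cong₂ _∷_ (eq zero) (eval*-projections (ρ ∘ suc) (eq ∘ suc))

numeral : ∀ {n} → ℕ → PR n
numeral zero    = zer
numeral (suc k) = comp succ (numeral k ∷ [])

eval-numeral : ∀ {n} k {xs : Vec ℕ n} → eval (numeral k) xs ≡ k
eval-numeral zero    = refl
eval-numeral (suc k) = cong suc (eval-numeral k)

add mul pair : PR 2
add  = rec (proj zero) (comp succ (proj (suc zero) ∷ []))
mul  = rec zer (comp add (proj (suc (suc zero)) ∷ proj (suc zero) ∷ []))

pow₂ : PR 1
pow₂ = rec (numeral 1) (comp mul (numeral 2 ∷ proj (suc zero) ∷ []))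

pair = comp mul (comp pow₂ (proj zero ∷ []) ∷
                 comp succ (comp mul (numeral 2 ∷ proj (suc zero) ∷ []) ∷ []) ∷ [])

eval-add : ∀ a b → eval add (a ∷ b ∷ []) ≡ a + b
eval-add zero    b = refl
eval-add (suc a) b = cong suc (eval-add a b)

eval-mul : ∀ a b → eval mul (a ∷ b ∷ []) ≡ a * b
eval-mul zero    b = refl
eval-mul (suc a) b =
  trans (eval-add b (eval mul (a ∷ b ∷ []))) (cong (b +_) (eval-mul a b))

eval-pow₂ : ∀ a → eval pow₂ (a ∷ []) ≡ 2 ^ a
eval-pow₂ zero    = refl
eval-pow₂ (suc a) = trans (eval-mul 2 (eval pow₂ (a ∷ []))) (cong (2 *_) (eval-pow₂ a))

eval-pair : ∀ a b → eval pair (a ∷ b ∷ []) ≡ ⟨ a , b ⟩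
eval-pair a b = trans
  (eval-mul (eval pow₂ (a ∷ [])) (suc (eval mul (2 ∷ b ∷ []))))
  (cong₂ _*_ (eval-pow₂ a) (cong suc (eval-mul 2 b)))

-- Pairs and codes are opaque because unfolding the arithmetic of nested pairs
-- is infeasible.
opaque
  ⟪_,_⟫ : ℕ → ℕ → ℕ
  ⟪ a , b ⟫ = ⟨ a , b ⟩

  ⟪⟫≡⟨⟩ : ∀ a b → ⟪ a , b ⟫ ≡ ⟨ a , b ⟩
  ⟪⟫≡⟨⟩ a b = refl

  code : ∀ {n} → PR n → ℕ
  code = ⌜_⌝

  code* : ∀ {m n} → Vec (PR n) m → ℕ
  code* = ⌜_⌝*

  codeᵈ : Description → ℕ
  codeᵈ = descriptionCode

  codeᵈ≡descriptionCode : ∀ d → codeᵈ d ≡ descriptionCode d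
  codeᵈ≡descriptionCode d = refl

  codeᵈ-⟪⟫ : ∀ d → let open Description d in
    codeᵈ d ≡ ⟪ code isOp , ⟪ code ar , ⟪ code isState , ⟪ code rule , 0 ⟫ ⟫ ⟫ ⟫
  codeᵈ-⟪⟫ d = refl

  code-zer : ∀ {n} → code (zer {n}) ≡ ⟪ 0 , 0 ⟫
  code-zer = refl

  code-succ : code succ ≡ ⟪ 1 , 0 ⟫
  code-succ = refl

  code-comp : ∀ {m n} (f : PR m) (gs : Vec (PR n) m) →
              code (comp f gs) ≡ ⟪ 3 , ⟪ code* gs , code f ⟫ ⟫
  code-comp f gs = refl

  code*-[] : ∀ {n} → code* {n = n} [] ≡ 0
  code*-[] = refl

  code*-∷ : ∀ {m n} (g : PR n) (gs : Vec (PR n) m) →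
            code* (g ∷ gs) ≡ ⟪ code g , code* gs ⟫
  code*-∷ g gs = refl

  pairOf : ∀ {n} → PR n → PR n → PR n
  pairOf p q = comp pair (p ∷ q ∷ [])

  eval-pairOf : ∀ {n} (p q : PR n) {xs a b} → eval p xs ≡ a → eval q xs ≡ b →
                eval (pairOf p q) xs ≡ ⟪ a , b ⟫
  eval-pairOf p q {xs} refl refl = eval-pair (eval p xs) (eval q xs)

-- These act on results coded as 0 for no value and `suc v` for the value `v`. `guard` propagates
-- the absence of a value, `ifOne` accepts only the value 0, and `advance` moves a search on only
-- past a positive value, so that it gets stuck at missing values as well as at zeros.
guard ifZero ifOne advance : ℕ → ℕ → ℕ
guard zero    w = 0
guard (suc _) w = w
ifZero zero    w = w
ifZero (suc _) w = 0
ifOne zero    w = 0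
ifOne (suc k) w = ifZero k w
advance zero          i = i
advance (suc zero)    i = i
advance (suc (suc _)) i = suc i

guard-≡0 : ∀ {k w} → k ≡ 0 → guard k w ≡ 0
guard-≡0 refl = refl

predᴾ : PR 1
predᴾ = rec zer (proj zero)

eval-predᴾ : ∀ k → eval predᴾ (k ∷ []) ≡ pred k
eval-predᴾ zero    = refl
eval-predᴾ (suc k) = refl

guardᴾ ifOneᴾ advanceᴾ : PR 2
guardᴾ   = rec zer (proj (suc (suc zero)))
ifOneᴾ   = rec zer (comp (rec (proj zero) zer) (proj zero ∷ proj (suc (suc zero)) ∷ []))
advanceᴾ = rec (proj zero)
  (comp (rec (proj zero) (comp succ (proj (suc (suc zero)) ∷ [])))
        (proj zero ∷ proj (suc (suc zero)) ∷ []))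

eval-guardᴾ : ∀ k w → eval guardᴾ (k ∷ w ∷ []) ≡ guard k w
eval-guardᴾ zero    w = refl
eval-guardᴾ (suc k) w = refl

eval-ifOneᴾ : ∀ k w → eval ifOneᴾ (k ∷ w ∷ []) ≡ ifOne k w
eval-ifOneᴾ zero          w = refl
eval-ifOneᴾ (suc zero)    w = refl
eval-ifOneᴾ (suc (suc k)) w = refl

eval-advanceᴾ : ∀ k w → eval advanceᴾ (k ∷ w ∷ []) ≡ advance k w
eval-advanceᴾ zero          w = refl
eval-advanceᴾ (suc zero)    w = refl
eval-advanceᴾ (suc (suc k)) w = refl

-- Recursion serves as case distinction: the step ignores the recursive value and hands the
-- predecessor to the remaining branches. Past the last branch the value is 0, on which
-- `isOperation` and `residueᴾ` rely.
cases : ∀ {m n} → Vec (PR n) m → PR (suc n)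
cases []       = zer
cases (b ∷ bs) = rec b (comp (cases bs) (proj zero ∷ projections (λ i → suc (suc i))))

eval-cases : ∀ {m n} (bs : Vec (PR n) m) (i : Fin m) (xs : Vec ℕ n) →
             eval (cases bs) (toℕ i ∷ xs) ≡ eval (lookup bs i) xs
eval-cases (b ∷ bs) zero    xs = refl
eval-cases {n = n} (b ∷ bs) (suc i) xs = trans
  (cong (λ ys → eval (cases bs) (toℕ i ∷ ys))
        (eval*-projections {n = 2 + n} (λ j → suc (suc j)) (λ _ → refl)))
  (eval-cases bs i xs)

-- The recursion theorem

-- Gödel numbers do not record arities, so one function yields the codes of the numerals of every
-- arity.
numeralCode : PR 1
numeralCode = rec (pairOf zer zer)
  (pairOf (numeral 3) (pairOf (pairOf (proj (suc zero)) zer) (pairOf (numeral 1) zer)))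

eval-numeralCode : ∀ {n} k → eval numeralCode (k ∷ []) ≡ code (numeral {n} k)
eval-numeralCode     zero    = trans (eval-pairOf zer zer refl refl) (sym code-zer)
eval-numeralCode {n} (suc k) = begin
  eval numeralCode (suc k ∷ [])
    ≡⟨ eval-pairOf (numeral 3) _ refl
         (eval-pairOf _ _
           (eval-pairOf (proj (suc zero)) zer (eval-numeralCode {n} k) refl)
           (eval-pairOf (numeral 1) zer refl refl)) ⟩
  ⟪ 3 , ⟪ ⟪ code (numeral k) , 0 ⟫ , ⟪ 1 , 0 ⟫ ⟫ ⟫
    ≡⟨ cong₂ (λ a b → ⟪ 3 , ⟪ ⟪ code (numeral {n} k) , a ⟫ , b ⟫ ⟫) (sym code*-[]) (sym code-succ) ⟩
  ⟪ 3 , ⟪ ⟪ code (numeral k) , code* [] ⟫ , code succ ⟫ ⟫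
    ≡⟨ cong (λ a → ⟪ 3 , ⟪ a , code succ ⟫ ⟫) (sym (code*-∷ (numeral k) [])) ⟩
  ⟪ 3 , ⟪ code* (numeral k ∷ []) , code succ ⟫ ⟫
    ≡⟨ sym (code-comp succ (numeral k ∷ [])) ⟩
  code (numeral {n} (suc k)) ∎
  where open ≡-Reasoning

-- The diagonal instance of the s-m-n construction: the first argument of `g` is frozen to the code
-- of `g`.
selfApply : ∀ {n} → PR (suc n) → PR n
selfApply g = comp g (numeral (code g) ∷ projections (λ i → i))

-- Maps the code of `g` to that of `selfApply g`; `c` stands for the code of the list of
-- projections, which is the same for all `g` of one arity.
selfApplyCode : ∀ {m} → ℕ → PR (suc m)
selfApplyCode c = pairOf (numeral 3)
  (pairOf (pairOf (comp numeralCode (proj zero ∷ [])) (numeral c)) (proj zero))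

eval-selfApplyCode :
  ∀ {m n} (g : PR (suc n)) (xs : Vec ℕ m) →
  eval (selfApplyCode (code* (projections {n} (λ i → i)))) (code g ∷ xs) ≡ code (selfApply g)
eval-selfApplyCode {n = n} g xs = begin
  eval (selfApplyCode c) (code g ∷ xs)
    ≡⟨ eval-pairOf (numeral 3) _ refl
         (eval-pairOf _ (proj zero)
           (eval-pairOf (comp numeralCode (proj zero ∷ [])) (numeral c)
             (eval-numeralCode {n} (code g)) (eval-numeral c))
           refl) ⟩
  ⟪ 3 , ⟪ ⟪ code (numeral {n} (code g)) , c ⟫ , code g ⟫ ⟫
    ≡⟨ cong (λ a → ⟪ 3 , ⟪ a , code g ⟫ ⟫) (sym (code*-∷ (numeral (code g)) _)) ⟩
  ⟪ 3 , ⟪ code* (numeral (code g) ∷ projections (λ i → i)) , code g ⟫ ⟫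
    ≡⟨ sym (code-comp g _) ⟩
  code (selfApply g) ∎
  where
  open ≡-Reasoning
  c = code* (projections {n} (λ i → i))

-- Kleene's argument: `g` feeds `F` the code of the self-application of its first argument. Applied
-- to its own code, `g` thus feeds `F` the code of `selfApply g`, which is the fixed point itself.
-- All of this stays primitive recursive.
recursionTheorem : ∀ {n} (F : PR (suc n)) →
                   ∃ λ r → ∀ xs → eval r xs ≡ eval F (code r ∷ xs)
recursionTheorem {n} F = selfApply g , λ xs → trans
  (cong (eval g) (cong₂ _∷_ (eval-numeral (code g)) (eval*-projections (λ i → i) (λ _ → refl))))
  (cong (eval F) (cong₂ _∷_ (eval-selfApplyCode g xs) (eval*-projections suc (λ _ → refl))))
  where
  g : PR (suc n)
  g = comp F (selfApplyCode (code* (projections {n} (λ i → i))) ∷ projections suc)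

-- Evaluation of recursive functions with bounded search

-- The candidate reached after the given number of steps from 0; it stays at the first `i` where
-- `φ i` codes no value or the value 0.
search : (ℕ → ℕ) → ℕ → ℕ
search φ zero    = 0
search φ (suc j) = advance (φ (search φ j)) (search φ j)

allPositive : ∀ {m} → Vec ℕ m → ℕ
allPositive []       = 1
allPositive (w ∷ ws) = guard w (allPositive ws)

-- The result 0 means that no value has been found, suc v that it is v.
run  : ∀ {n} → Rec n → ℕ → Vec ℕ n → ℕ
run* : ∀ {m n} → Vec (Rec n) m → ℕ → Vec ℕ n → Vec ℕ m

run zer         b xs           = 1
run succ        b (k ∷ [])     = suc (suc k)
run (proj i)    b xs           = suc (lookup xs i)
run (comp f gs) b xs           =
  guard (allPositive (run* gs b xs)) (run f b (map pred (run* gs b xs)))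
run (rec f g)   b (zero ∷ xs)  = run f b xs
run (rec f g)   b (suc k ∷ xs) =
  guard (run (rec f g) b (k ∷ xs)) (run g b (k ∷ pred (run (rec f g) b (k ∷ xs)) ∷ xs))
-- The candidate counts only if its value is 0, since the search may also have been cut off by the
-- bound or stuck at a missing value.
run (min f)     b xs           =
  ifOne (run f b (search (λ i → run f b (i ∷ xs)) b ∷ xs))
        (suc (search (λ i → run f b (i ∷ xs)) b))

run* []       b xs = []
run* (g ∷ gs) b xs = run g b xs ∷ run* gs b xs

allPositiveᴾ : ∀ {m n} → Vec (PR n) m → PR n
allPositiveᴾ []       = numeral 1
allPositiveᴾ (p ∷ ps) = comp guardᴾ (p ∷ allPositiveᴾ ps ∷ [])

eval-allPositiveᴾ : ∀ {m n} (ps : Vec (PR n) m) (xs : Vec ℕ n) →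
                    eval (allPositiveᴾ ps) xs ≡ allPositive (eval* ps xs)
eval-allPositiveᴾ []       xs = refl
eval-allPositiveᴾ (p ∷ ps) xs =
  trans (eval-guardᴾ (eval p xs) _) (cong (guard (eval p xs)) (eval-allPositiveᴾ ps xs))

predsᴾ : ∀ {m n} → Vec (PR n) m → Vec (PR n) m
predsᴾ = map (λ p → comp predᴾ (p ∷ []))

eval*-predsᴾ : ∀ {m n} (ps : Vec (PR n) m) (xs : Vec ℕ n) →
               eval* (predsᴾ ps) xs ≡ map pred (eval* ps xs)
eval*-predsᴾ []       xs = refl
eval*-predsᴾ (p ∷ ps) xs = cong₂ _∷_ (eval-predᴾ (eval p xs)) (eval*-predsᴾ ps xs)

-- The number of steps and the bound `b` passed to `p` are separate arguments, so that induction on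
-- the former keeps the latter fixed; `compile` sets both to the bound.
searchᴾ : ∀ {n} → PR (2 + n) → PR (2 + n)
searchᴾ p = rec zer
  (comp advanceᴾ (comp p (proj (suc (suc zero)) ∷ proj (suc zero) ∷ projections (λ i → suc (suc (suc i)))) ∷
                  proj (suc zero) ∷ []))

eval-searchᴾ : ∀ {n} (p : PR (2 + n)) φ b xs → (∀ i → eval p (b ∷ i ∷ xs) ≡ φ i) →
               ∀ j → eval (searchᴾ p) (j ∷ b ∷ xs) ≡ search φ j
eval-searchᴾ p φ b xs eq zero    = refl
eval-searchᴾ p φ b xs eq (suc j) = begin
  eval advanceᴾ (eval p (b ∷ i ∷ eval* (projections (λ i → suc (suc (suc i)))) (j ∷ i ∷ b ∷ xs)) ∷ i ∷ [])
    ≡⟨ eval-advanceᴾ _ i ⟩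
  advance (eval p (b ∷ i ∷ eval* (projections (λ i → suc (suc (suc i)))) (j ∷ i ∷ b ∷ xs))) i
    ≡⟨ cong (λ ys → advance (eval p (b ∷ i ∷ ys)) i) (eval*-projections _ (λ _ → refl)) ⟩
  advance (eval p (b ∷ i ∷ xs)) i
    ≡⟨ cong₂ advance (trans (eq i) (cong φ IH)) IH ⟩
  advance (φ (search φ j)) (search φ j) ∎
  where
  open ≡-Reasoning
  i  = eval (searchᴾ p) (j ∷ b ∷ xs)
  IH = eval-searchᴾ p φ b xs eq j

compile  : ∀ {n} → Rec n → PR (suc n)
compile* : ∀ {m n} → Vec (Rec n) m → Vec (PR (suc n)) m

-- Recursion acts on the first argument, so here the bound comes second; `compile` swaps the two.
compile-rec : ∀ {n} → PR (suc n) → PR (3 + n) → PR (2 + n)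
compile-rec p q = rec p
  (comp guardᴾ (proj (suc zero) ∷
                comp q (proj (suc (suc zero)) ∷ proj zero ∷ comp predᴾ (proj (suc zero) ∷ []) ∷
                        projections (λ i → suc (suc (suc i)))) ∷ []))

compile zer         = numeral 1
compile succ        = comp succ (comp succ (proj (suc zero) ∷ []) ∷ [])
compile (proj i)    = comp succ (proj (suc i) ∷ [])
compile (comp f gs) = comp guardᴾ
  (allPositiveᴾ (compile* gs) ∷ comp (compile f) (proj zero ∷ predsᴾ (compile* gs)) ∷ [])
compile (rec f g)   = comp (compile-rec (compile f) (compile g))
  (proj (suc zero) ∷ proj zero ∷ projections (λ i → suc (suc i)))
compile (min f)     = comp ifOneᴾ
  (comp (compile f) (proj zero ∷ least ∷ projections suc) ∷ comp succ (least ∷ []) ∷ [])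
  where least = comp (searchᴾ (compile f)) (proj zero ∷ proj zero ∷ projections suc)

compile* []       = []
compile* (g ∷ gs) = compile g ∷ compile* gs

eval-compile  : ∀ {n} (e : Rec n) b xs → eval (compile e) (b ∷ xs) ≡ run e b xs
eval*-compile : ∀ {m n} (gs : Vec (Rec n) m) b xs → eval* (compile* gs) (b ∷ xs) ≡ run* gs b xs

eval-compile-rec : ∀ {n} (f : Rec n) g b k xs →
                   eval (compile-rec (compile f) (compile g)) (k ∷ b ∷ xs) ≡ run (rec f g) b (k ∷ xs)
eval-compile-rec f g b zero    xs = eval-compile f b xs
eval-compile-rec f g b (suc k) xs = begin
  eval guardᴾ (u ∷ eval (compile g) (b ∷ k ∷ eval predᴾ (u ∷ []) ∷ ys) ∷ [])
    ≡⟨ eval-guardᴾ u _ ⟩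
  guard u (eval (compile g) (b ∷ k ∷ eval predᴾ (u ∷ []) ∷ ys))
    ≡⟨ cong₂ (λ v zs → guard u (eval (compile g) (b ∷ k ∷ v ∷ zs)))
             (eval-predᴾ u) (eval*-projections _ (λ _ → refl)) ⟩
  guard u (eval (compile g) (b ∷ k ∷ pred u ∷ xs))
    ≡⟨ cong (guard u) (eval-compile g b (k ∷ pred u ∷ xs)) ⟩
  guard u (run g b (k ∷ pred u ∷ xs))
    ≡⟨ cong (λ v → guard v (run g b (k ∷ pred v ∷ xs))) (eval-compile-rec f g b k xs) ⟩
  run (rec f g) b (suc k ∷ xs) ∎
  where
  open ≡-Reasoning
  u  = eval (compile-rec (compile f) (compile g)) (k ∷ b ∷ xs)
  ys = eval* (projections (λ i → suc (suc (suc i)))) (k ∷ u ∷ b ∷ xs)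

eval-compile zer         b xs       = refl
eval-compile succ        b (k ∷ []) = refl
eval-compile (proj i)    b xs       = refl
eval-compile (comp f gs) b xs       = begin
  eval guardᴾ (eval (allPositiveᴾ ps) (b ∷ xs) ∷ eval (compile f) (b ∷ eval* (predsᴾ ps) (b ∷ xs)) ∷ [])
    ≡⟨ eval-guardᴾ (eval (allPositiveᴾ ps) (b ∷ xs)) _ ⟩
  guard (eval (allPositiveᴾ ps) (b ∷ xs)) (eval (compile f) (b ∷ eval* (predsᴾ ps) (b ∷ xs)))
    ≡⟨ cong₂ (λ v ys → guard v (eval (compile f) (b ∷ ys)))
             (eval-allPositiveᴾ ps (b ∷ xs)) (eval*-predsᴾ ps (b ∷ xs)) ⟩
  guard (allPositive (eval* ps (b ∷ xs))) (eval (compile f) (b ∷ map pred (eval* ps (b ∷ xs))))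
    ≡⟨ cong (λ ws → guard (allPositive ws) (eval (compile f) (b ∷ map pred ws))) (eval*-compile gs b xs) ⟩
  guard (allPositive ws) (eval (compile f) (b ∷ map pred ws))
    ≡⟨ cong (guard (allPositive ws)) (eval-compile f b (map pred ws)) ⟩
  run (comp f gs) b xs ∎
  where
  open ≡-Reasoning
  ps = compile* gs
  ws = run* gs b xs
eval-compile (rec f g)   b (k ∷ xs) = trans
  (cong (λ ys → eval (compile-rec (compile f) (compile g)) (k ∷ b ∷ ys))
        (eval*-projections (λ i → suc (suc i)) (λ _ → refl)))
  (eval-compile-rec f g b k xs)
eval-compile (min f)     b xs       = begin
  eval ifOneᴾ (eval p (b ∷ u ∷ eval* (projections suc) (b ∷ xs)) ∷ suc u ∷ [])
    ≡⟨ eval-ifOneᴾ (eval p (b ∷ u ∷ eval* (projections suc) (b ∷ xs))) (suc u) ⟩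
  ifOne (eval p (b ∷ u ∷ eval* (projections suc) (b ∷ xs))) (suc u)
    ≡⟨ cong₂ (λ v ys → ifOne (eval p (b ∷ v ∷ ys)) (suc v)) found (eval*-projections suc (λ _ → refl)) ⟩
  ifOne (eval p (b ∷ v ∷ xs)) (suc v)
    ≡⟨ cong (λ w → ifOne w (suc v)) (eval-compile f b (v ∷ xs)) ⟩
  run (min f) b xs ∎
  where
  open ≡-Reasoning
  p = compile f
  u = eval (searchᴾ p) (b ∷ b ∷ eval* (projections suc) (b ∷ xs))
  v = search (λ i → run f b (i ∷ xs)) b
  found : u ≡ v
  found = trans
    (cong (λ ys → eval (searchᴾ p) (b ∷ b ∷ ys)) (eval*-projections suc (λ _ → refl)))
    (eval-searchᴾ p _ b xs (λ i → eval-compile f b (i ∷ xs)) b)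

eval*-compile []       b xs = refl
eval*-compile (g ∷ gs) b xs = cong₂ _∷_ (eval-compile g b xs) (eval*-compile gs b xs)

-- Soundness and completeness of bounded evaluation

Eventually : (ℕ → Set) → Set
Eventually P = ∃ λ N → ∀ b → N ≤ b → P b

eventually-map₂ : {P Q R : ℕ → Set} → (∀ b → P b → Q b → R b) →
                  Eventually P → Eventually Q → Eventually R
eventually-map₂ f (M , p) (N , q) = M ⊔ N , λ b le →
  f b (p b (≤-trans (m≤m⊔n M N) le)) (q b (≤-trans (m≤n⊔m M N) le))

-- Finitely many thresholds have a maximum. This gives one bound for all evaluations below the
-- result of a minimisation.
eventually-< : ∀ {P : ℕ → ℕ → Set} k → (∀ i → i < k → Eventually (P i)) →
               Eventually (λ b → ∀ i → i < k → P i b)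
eventually-< zero    ev = 0 , λ _ _ _ ()
eventually-< {P} (suc k) ev = eventually-map₂ combine
  (ev k (n<1+n k)) (eventually-< k (λ i i<k → ev i (m<n⇒m<1+n i<k)))
  where
  combine : ∀ b → P k b → (∀ i → i < k → P i b) → ∀ i → i < suc k → P i b
  combine b p ps i i<1+k with m<1+n⇒m<n∨m≡n i<1+k
  ... | inj₁ i<k  = ps i i<k
  ... | inj₂ refl = p

infix 4 _≼_

-- The flat information order: `w` codes no value or exactly `v`.
_≼_ : ℕ → ℕ → Set
w ≼ v = w ≡ 0 ⊎ w ≡ suc v

allPositive-suc : ∀ {m} (vs : Vec ℕ m) → allPositive (map suc vs) ≡ 1
allPositive-suc []       = refl
allPositive-suc (v ∷ vs) = allPositive-suc vs

pred-suc : ∀ {m} (vs : Vec ℕ m) → map pred (map suc vs) ≡ vs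
pred-suc []       = refl
pred-suc (v ∷ vs) = cong (v ∷_) (pred-suc vs)

run-comp : ∀ {m n} (f : Rec m) (gs : Vec (Rec n) m) b {xs vs} →
           run* gs b xs ≡ map suc vs → run (comp f gs) b xs ≡ run f b vs
run-comp f gs b {vs = vs} eq
  rewrite eq | allPositive-suc vs | pred-suc vs = refl

run-recₛ : ∀ {n} (f : Rec n) g b {k xs u} → run (rec f g) b (k ∷ xs) ≡ suc u →
           run (rec f g) b (suc k ∷ xs) ≡ run g b (k ∷ u ∷ xs)
run-recₛ f g b eq rewrite eq = refl

advance-≤ : ∀ w i → advance w i ≤ suc i
advance-≤ zero          i = n≤1+n i
advance-≤ (suc zero)    i = n≤1+n i
advance-≤ (suc (suc w)) i = ≤-refl

advance-≼0 : ∀ {w} i → w ≼ 0 → advance w i ≡ i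
advance-≼0 i (inj₁ refl) = refl
advance-≼0 i (inj₂ refl) = refl

module _ (φ : ℕ → ℕ) (k : ℕ) where

  -- Candidates grow by at most one per step, and `φ k` lets none past `k`.
  search-≤ : φ k ≼ 0 → ∀ j → search φ j ≤ k
  search-≤ φk zero    = z≤n
  search-≤ φk (suc j) with m≤n⇒m<n∨m≡n (search-≤ φk j)
  ... | inj₁ s<k = ≤-trans (advance-≤ (φ (search φ j)) (search φ j)) s<k
  ... | inj₂ s≡k rewrite s≡k | advance-≼0 k φk = ≤-refl

  -- A candidate below `k` is rejected, because its value is missing or positive; the only other
  -- candidate is `k` itself.
  search-sound : (∀ i → i < k → ∃ λ v → φ i ≼ suc v) → φ k ≼ 0 →
                 ∀ j → ifOne (φ (search φ j)) (suc (search φ j)) ≼ k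
  search-sound φ< φk j with m≤n⇒m<n∨m≡n (search-≤ φk j)
  ... | inj₁ s<k = inj₁ (below (φ< (search φ j) s<k))
    where
    below : (∃ λ v → φ (search φ j) ≼ suc v) →
            ifOne (φ (search φ j)) (suc (search φ j)) ≡ 0
    below (v , inj₁ eq) rewrite eq = refl
    below (v , inj₂ eq) rewrite eq = refl
  ... | inj₂ s≡k rewrite s≡k with φk
  ...   | inj₁ eq rewrite eq = inj₁ refl
  ...   | inj₂ eq rewrite eq = inj₂ refl

  search-climbs : (∀ i → i < k → ∃ λ v → φ i ≡ suc (suc v)) →
                  ∀ j → j ≤ k → search φ j ≡ j
  search-climbs φ< zero    _   = refl
  search-climbs φ< (suc j) j<k
    rewrite search-climbs φ< j (<⇒≤ j<k) | proj₂ (φ< j j<k) = refl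

  search-stays : (∀ i → i < k → ∃ λ v → φ i ≡ suc (suc v)) → φ k ≡ 1 →
                 ∀ j → search φ (j + k) ≡ k
  search-stays φ< φk zero    = search-climbs φ< k ≤-refl
  search-stays φ< φk (suc j) rewrite search-stays φ< φk j | φk = refl

  -- The first `k` steps climb to `k`, and the remaining `b ∸ k` steps stay there.
  search-complete : (∀ i → i < k → ∃ λ v → φ i ≡ suc (suc v)) → φ k ≡ 1 →
                    ∀ b → k ≤ b → ifOne (φ (search φ b)) (suc (search φ b)) ≡ suc k
  search-complete φ< φk b k≤b = trans
    (cong (λ i → ifOne (φ i) (suc i))
          (subst (λ c → search φ c ≡ k) (m∸n+n≡m k≤b) (search-stays φ< φk (b ∸ k))))
    (cong (λ w → ifOne w (suc k)) φk)

-- Too small a bound may lose a value but never produces a wrong one. Hence if `e` answers 0, no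
-- bound makes it appear to answer 1.
run-sound  : ∀ {n} {e : Rec n} {xs v} → e [ xs ]⇓ v → ∀ b → run e b xs ≼ v
run*-sound : ∀ {m n} {gs : Vec (Rec n) m} {xs vs} → gs [ xs ]⇓* vs →
             ∀ b → allPositive (run* gs b xs) ≡ 0 ⊎ run* gs b xs ≡ map suc vs

run-sound ⇓zer  b = inj₂ refl
run-sound ⇓succ b = inj₂ refl
run-sound ⇓proj b = inj₂ refl
run-sound (⇓comp {f = f} {gs} ds d) b with run*-sound ds b
... | inj₁ eq = inj₁ (guard-≡0 eq)
... | inj₂ eq = subst (_≼ _) (sym (run-comp f gs b eq)) (run-sound d b)
run-sound (⇓rec₀ d) b = run-sound d b
run-sound (⇓recₛ {f = f} {g} d d′) b with run-sound d b
... | inj₁ eq = inj₁ (guard-≡0 eq)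
... | inj₂ eq = subst (_≼ _) (sym (run-recₛ f g b eq)) (run-sound d′ b)
run-sound (⇓min {f = f} {xs} {k} ds d) b =
  search-sound (λ i → run f b (i ∷ xs)) k
    (λ i i<k → proj₁ (ds i i<k) , run-sound (proj₂ (ds i i<k)) b) (run-sound d b) b

run*-sound []       b = inj₂ refl
run*-sound (d ∷ ds) b with run-sound d b | run*-sound ds b
... | inj₁ eq | _        = inj₁ (guard-≡0 eq)
... | inj₂ eq | inj₁ eqs = inj₁ (trans (cong (λ w → guard w _) eq) eqs)
... | inj₂ eq | inj₂ eqs = inj₂ (cong₂ _∷_ eq eqs)

run-complete  : ∀ {n} {e : Rec n} {xs v} → e [ xs ]⇓ v →
                Eventually (λ b → run e b xs ≡ suc v)
run*-complete : ∀ {m n} {gs : Vec (Rec n) m} {xs vs} → gs [ xs ]⇓* vs →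
                Eventually (λ b → run* gs b xs ≡ map suc vs)

run-complete ⇓zer  = 0 , λ _ _ → refl
run-complete ⇓succ = 0 , λ _ _ → refl
run-complete ⇓proj = 0 , λ _ _ → refl
run-complete (⇓comp {f = f} {gs} ds d) = eventually-map₂
  (λ b eqs eq → trans (run-comp f gs b eqs) eq) (run*-complete ds) (run-complete d)
run-complete (⇓rec₀ d) = run-complete d
run-complete (⇓recₛ {f = f} {g} d d′) = eventually-map₂
  (λ b eq eq′ → trans (run-recₛ f g b eq) eq′) (run-complete d) (run-complete d′)
run-complete (⇓min {f = f} {xs} {k} ds d) = eventually-map₂
  (λ b (φ< , φk) → search-complete (λ i → run f b (i ∷ xs)) k φ< φk b)
  (eventually-map₂ (λ _ → _,_) (eventually-< k below) (run-complete d))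
  -- The bound must also leave the search enough steps to reach `k`.
  (k , λ _ k≤b → k≤b)
  where
  below : ∀ i → i < k → Eventually (λ b → ∃ λ v → run f b (i ∷ xs) ≡ suc (suc v))
  below i i<k = let N , p = run-complete (proj₂ (ds i i<k)) in
                N , λ b N≤b → proj₁ (ds i i<k) , p b N≤b

run*-complete []       = 0 , λ _ _ → refl
run*-complete (d ∷ ds) =
  eventually-map₂ (λ _ → cong₂ _∷_) (run-complete d) (run*-complete ds)

-- The mode of a premiss, read off the code of the list consisting of it:
-- this code is 2 ^ ⟨ 0 , s ⟩ or 2 ^ ⟨ 1 , s ⟩, whose exponents differ in
-- parity, so it is 2 or 1 modulo 3.

next double : ℕ → ℕ
next zero          = 1
next (suc zero)    = 2
next (suc (suc _)) = 0
double zero          = 0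
double (suc zero)    = 2
double (suc (suc _)) = 1

next-next-double : ∀ r → next (next (double r)) ≡ double (next r)
next-next-double zero          = refl
next-next-double (suc zero)    = refl
next-next-double (suc (suc _)) = refl

residue : ℕ → ℕ
residue zero    = 0
residue (suc k) = next (residue k)

residueᴾ : PR 1
residueᴾ = rec zer (comp (cases (numeral 1 ∷ numeral 2 ∷ [])) (proj (suc zero) ∷ []))

eval-residueᴾ : ∀ k → eval residueᴾ (k ∷ []) ≡ residue k
eval-residueᴾ zero    = refl
eval-residueᴾ (suc k) = trans (step (eval residueᴾ (k ∷ []))) (cong next (eval-residueᴾ k))
  where
  step : ∀ r → eval (cases (numeral 1 ∷ numeral 2 ∷ [])) (r ∷ []) ≡ next r
  step zero          = refl
  step (suc zero)    = refl
  step (suc (suc _)) = refl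

residue-double : ∀ k → residue (k + k) ≡ double (residue k)
residue-double zero    = refl
residue-double (suc k) rewrite +-suc k k | residue-double k = next-next-double (residue k)

residue-2^suc : ∀ k → residue (2 ^ suc k) ≡ double (residue (2 ^ k))
residue-2^suc k rewrite +-identityʳ (2 ^ k) = residue-double (2 ^ k)

residue-2^even : ∀ k → residue (2 ^ (k + k)) ≡ 1
residue-2^even zero    = refl
residue-2^even (suc k)
  rewrite +-suc k k | residue-2^suc (suc (k + k)) | residue-2^suc (k + k) | residue-2^even k = refl

residue-2^odd : ∀ k → residue (2 ^ suc (k + k)) ≡ 2
residue-2^odd k rewrite residue-2^suc (k + k) | residue-2^even k = refl

residue-te : ∀ s → residue ⟨ ⟨ 0 , s ⟩ , 0 ⟩ ≡ 2
residue-te s = begin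
  residue (2 ^ ⟨ 0 , s ⟩ * 1)   ≡⟨ cong residue (*-identityʳ (2 ^ ⟨ 0 , s ⟩)) ⟩
  residue (2 ^ ⟨ 0 , s ⟩)       ≡⟨ cong (λ k → residue (2 ^ k)) (+-identityʳ (1 + 2 * s)) ⟩
  residue (2 ^ (1 + 2 * s))     ≡⟨ cong (λ k → residue (2 ^ suc (s + k))) (+-identityʳ s) ⟩
  residue (2 ^ suc (s + s))     ≡⟨ residue-2^odd s ⟩
  2                             ∎
  where open ≡-Reasoning

residue-pr : ∀ s → residue ⟨ ⟨ 1 , s ⟩ , 0 ⟩ ≡ 1
residue-pr s = begin
  residue (2 ^ ⟨ 1 , s ⟩ * 1)   ≡⟨ cong residue (*-identityʳ (2 ^ ⟨ 1 , s ⟩)) ⟩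
  residue (2 ^ (2 * k))         ≡⟨ cong (λ l → residue (2 ^ (k + l))) (+-identityʳ k) ⟩
  residue (2 ^ (k + k))         ≡⟨ residue-2^even k ⟩
  1                             ∎
  where
  open ≡-Reasoning
  k = 1 + 2 * s

-- The specification

pattern halt    = zero
pattern probe   = suc zero
pattern toHalt  = suc (suc zero)
pattern toProbe = suc (suc (suc zero))
pattern restore = suc (suc (suc (suc zero)))

arities : Vec ℕ 5
arities = 0 ∷ 0 ∷ 0 ∷ 0 ∷ 1 ∷ []

probeSignature : Signature
probeSignature = record { Op = Fin 5 ; arity = lookup arities }

-- toHalt and toProbe move to state 0 before they become halt and probe,
-- whereas restore returns to the input state.
probeSpecification : (ℕ → ℕ) → Specification probeSignature ℕ
probeSpecification h halt    s []              = 0 , nothing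
probeSpecification h probe   s []              = h s , nothing
probeSpecification h toHalt  s []              = 0 , just (op halt [])
probeSpecification h toProbe s []              = 0 , just (op probe [])
probeSpecification h restore s ((_ , pr) ∷ []) = s , just (var (y zero refl))
-- Output `s` would separate `restore` of `halt` from `restore` of `toHalt`, although `halt` and
-- `toHalt` both terminate with 0.
probeSpecification h restore s ((_ , te) ∷ []) = 0 , nothing

-- Compositionality in terms of the output function `h`

Last-cong : ∀ {S : Set} {v w : PartialSeq S} {t} → (∀ k → v k ≡ w k) → Last v t → Last w t
Last-cong eq (k , last , end) = k , trans (sym (eq k)) last , trans (sym (eq (suc k))) end

module _ (h : ℕ → ℕ) where

  private
    L = probeSpecification h

  restored : ℕ → ℕ × Maybe (Program probeSignature) → ℕ × Maybe (Program probeSignature)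
  restored s (_ , just p)  = s , just p
  restored s (_ , nothing) = 0 , nothing

  γ₀-restore : ∀ s t → γ₀ L s (op restore (t ∷ [])) ≡ restored s (γ₀ L s t)
  γ₀-restore s t with γ₀ L s t
  ... | _ , just p  = refl
  ... | _ , nothing = refl

  module _ (h≡0 : ∀ s → h s ≡ 0) where

    restoredTrace : ℕ → Maybe ℕ → PartialSeq ℕ
    restoredTrace s nothing  zero          = just 0
    restoredTrace s (just _) zero          = just s
    restoredTrace s (just _) (suc zero)    = just 0
    restoredTrace s _        (suc _)       = nothing

    -- Only `halt` and `probe` ever occur as successors, as `restore` passes on the successor of its
    -- argument. With `h` zero both terminate with 0 in every state.
    successor-halts : ∀ s t {o p} → γ₀ L s t ≡ (o , just p) → ∀ s′ → γ₀ L s′ p ≡ (0 , nothing)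
    successor-halts s (op halt [])    ()
    successor-halts s (op probe [])   ()
    successor-halts s (op toHalt [])  refl s′ = refl
    successor-halts s (op toProbe []) refl s′ = cong (_, nothing) (h≡0 s′)
    successor-halts s (op restore (t ∷ [])) eq s′ with γ₀ L s t in eq′
    successor-halts s (op restore (t ∷ [])) refl s′ | _ , just p = successor-halts s t eq′ s′
    successor-halts s (op restore (t ∷ [])) ()   s′ | _ , nothing

    -- All that matters about `t` is whether it progresses in state `s`, which entry 1 of its trace
    -- reveals. Equal traces of arguments therefore give equal traces.
    trace-restore : ∀ t s k → trace L (op restore (t ∷ [])) s k ≡ restoredTrace s (trace L t s 1) k
    trace-restore t s k rewrite γ₀-restore s t with γ₀ L s t in eq
    trace-restore t s zero          | _ , nothing = refl
    trace-restore t s (suc _)       | _ , nothing = refl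
    trace-restore t s zero          | _ , just p  = refl
    trace-restore t s (suc zero)    | _ , just p  rewrite successor-halts s t eq s = refl
    trace-restore t s (suc (suc _)) | _ , just p  rewrite successor-halts s t eq s = refl

    Last-restoredTrace : ∀ s w → Last (restoredTrace s w) 0
    Last-restoredTrace s nothing  = 0 , refl , refl
    Last-restoredTrace s (just _) = 1 , refl , refl

    Last-restoredTrace-≡0 : ∀ s w {t} → Last (restoredTrace s w) t → 0 ≡ t
    Last-restoredTrace-≡0 s nothing  (zero , refl , _)         = refl
    Last-restoredTrace-≡0 s (just _) (suc zero , refl , _)     = refl
    Last-restoredTrace-≡0 s nothing  (suc _ , () , _)
    Last-restoredTrace-≡0 s (just _) (suc (suc _) , () , _)

    -- Both shapes of `restoredTrace` end in 0, so all programs headed by `restore` have the same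
    -- termination semantics.
    termination-restore : ∀ t s v → termination L (op restore (t ∷ [])) s v ⇔ 0 ≡ v
    termination-restore t s v = mk⇔
      (Last-restoredTrace-≡0 s _ ∘ Last-cong (trace-restore t s))
      (λ { refl → Last-cong (sym ∘ trace-restore t s) (Last-restoredTrace s _) })

    traceCompositional : TraceCompositional L
    traceCompositional halt    [] [] _ _ _ = refl
    traceCompositional probe   [] [] _ _ _ = refl
    traceCompositional toHalt  [] [] _ _ _ = refl
    traceCompositional toProbe [] [] _ _ _ = refl
    traceCompositional restore (t ∷ []) (u ∷ []) t≈u s k = begin
      trace L (op restore (t ∷ [])) s k   ≡⟨ trace-restore t s k ⟩
      restoredTrace s (trace L t s 1) k   ≡⟨ cong (λ w → restoredTrace s w k) (t≈u zero s 1) ⟩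
      restoredTrace s (trace L u s 1) k   ≡⟨ sym (trace-restore u s k) ⟩
      trace L (op restore (u ∷ [])) s k   ∎
      where open ≡-Reasoning

    terminationCompositional : TerminationCompositional L
    terminationCompositional halt    [] [] _ _ _ = ⇔.refl
    terminationCompositional probe   [] [] _ _ _ = ⇔.refl
    terminationCompositional toHalt  [] [] _ _ _ = ⇔.refl
    terminationCompositional toProbe [] [] _ _ _ = ⇔.refl
    terminationCompositional restore (t ∷ []) (u ∷ []) _ s v =
      ⇔.trans (termination-restore t s v) (⇔.sym (termination-restore u s v))

  module _ (h0≡0 : h 0 ≡ 0) where

    -- The successors `halt` and `probe` run in state 0, where their outputs are 0 and `h 0`.
    toHalt≈toProbe : ∀ s k → trace L (op toHalt []) s k ≡ trace L (op toProbe []) s k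
    toHalt≈toProbe s zero          = refl
    toHalt≈toProbe s (suc zero)    = cong just (sym h0≡0)
    toHalt≈toProbe s (suc (suc _)) = refl

    -- Under `restore` the successors run in state `s` instead, so entry 1 of the two traces is 0
    -- and `h s` respectively.
    ¬traceCompositional : ∀ s → h s ≢ 0 → ¬ TraceCompositional L
    ¬traceCompositional s hs≢0 compositional = hs≢0 (sym (just-injective
      (compositional restore (op toHalt [] ∷ []) (op toProbe [] ∷ [])
        (λ { zero → toHalt≈toProbe }) s 1)))

    ¬terminationCompositional : ∀ s → h s ≢ 0 → ¬ TerminationCompositional L
    ¬terminationCompositional s hs≢0 compositional = hs≢0 (last≡0
      (Equivalence.to
        (compositional restore (op toHalt [] ∷ []) (op toProbe [] ∷ [])
          (λ { zero s v → mk⇔ (Last-cong (toHalt≈toProbe s))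
                              (Last-cong (sym ∘ toHalt≈toProbe s)) }) s 0)
        (1 , refl , refl)))
      where
      last≡0 : termination L (op restore (op toProbe [] ∷ [])) s 0 → h s ≡ 0
      last≡0 (suc zero , eq , _) = just-injective eq

-- The description of the specification

isOperation arityOf isNumber : PR 1
isOperation = cases (replicate 5 (numeral 1))
arityOf     = cases (map numeral arities)
isNumber    = numeral 1

isOperation-correct : ∀ c → eval isOperation (c ∷ []) ≡ 1 ⇔ ∃ λ (f : Fin 5) → toℕ f ≡ c
isOperation-correct c = mk⇔ (to c) (from c)
  where
  one : ∀ f → eval (lookup (replicate 5 (numeral 1)) f) [] ≡ 1
  one f rewrite lookup-replicate f (numeral {0} 1) = refl

  from : ∀ c → (∃ λ (f : Fin 5) → toℕ f ≡ c) → eval isOperation (c ∷ []) ≡ 1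
  from _ (f , refl) = trans (eval-cases (replicate 5 (numeral 1)) f []) (one f)

  to : ∀ c → eval isOperation (c ∷ []) ≡ 1 → ∃ λ (f : Fin 5) → toℕ f ≡ c
  to 0 _ = halt , refl
  to 1 _ = probe , refl
  to 2 _ = toHalt , refl
  to 3 _ = toProbe , refl
  to 4 _ = restore , refl
  to (suc (suc (suc (suc (suc _))))) ()

arityOf-correct : ∀ f → eval arityOf (toℕ f ∷ []) ≡ lookup arities f
arityOf-correct f = begin
  eval arityOf (toℕ f ∷ [])                   ≡⟨ eval-cases (map numeral arities) f [] ⟩
  eval (lookup (map numeral arities) f) []    ≡⟨ cong (λ p → eval p []) (lookup-map f numeral arities) ⟩
  eval (numeral (lookup arities f)) []        ≡⟨ eval-numeral (lookup arities f) ⟩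
  lookup arities f                            ∎
  where open ≡-Reasoning

-- The arguments are a parameter, the input state and the code of the premisses.
branches : PR 3 → Vec (PR 3) 5
branches p =
  pairOf zer zer ∷
  pairOf p zer ∷
  -- The targets here and in the next branch are the term codes of `halt` and `probe`.
  pairOf zer (numeral ⟨ 2 , ⟨ 0 , 0 ⟩ ⟩) ∷
  pairOf zer (numeral ⟨ 2 , ⟨ 1 , 0 ⟩ ⟩) ∷
  -- Residue 1 selects the rule for a progressing premiss, whose target `y zero` has code
  -- `⟨ 1 , 0 ⟩`; residue 2 selects the rule for a terminating one.
  comp (cases (zer ∷ pairOf (proj zero) (numeral ⟨ 1 , 0 ⟩) ∷ pairOf zer zer ∷ []))
       (comp residueᴾ (proj (suc (suc zero)) ∷ []) ∷ proj (suc zero) ∷ []) ∷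
  []

-- The recursion theorem supplies the code of the rule function as first argument, but `cases`
-- branches on the operation symbol; hence the swap.
ruleBody : PR 3 → PR 4
ruleBody p = comp (cases (branches p))
  (proj (suc zero) ∷ proj zero ∷ proj (suc (suc zero)) ∷ proj (suc (suc (suc zero))) ∷ [])

operationCode : Fin 5 ↣ ℕ
operationCode = mk↣ toℕ-injective

stateCode : ℕ ↣ ℕ
stateCode = mk↣ id

open Encoding {probeSignature} operationCode stateCode using (premissesCode; conclusionCode)

eval-branches : ∀ p c h → (∀ s ls → eval p (c ∷ s ∷ ls ∷ []) ≡ h s) → ∀ f s ls →
                eval (lookup (branches p) f) (c ∷ s ∷ premissesCode ls ∷ [])
                  ≡ conclusionCode (probeSpecification h f s ls)
eval-branches p c h eq halt    s [] = trans (eval-pairOf zer zer refl refl) (⟪⟫≡⟨⟩ 0 0)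
eval-branches p c h eq probe   s [] = trans (eval-pairOf p zer (eq s _) refl) (⟪⟫≡⟨⟩ (h s) 0)
eval-branches p c h eq toHalt  s [] =
  trans (eval-pairOf zer (numeral ⟨ 2 , ⟨ 0 , 0 ⟩ ⟩) refl refl) (⟪⟫≡⟨⟩ 0 _)
eval-branches p c h eq toProbe s [] =
  trans (eval-pairOf zer (numeral ⟨ 2 , ⟨ 1 , 0 ⟩ ⟩) refl refl) (⟪⟫≡⟨⟩ 0 _)
eval-branches p c h eq restore s ((s′ , pr) ∷ [])
  rewrite eval-residueᴾ ⟨ ⟨ 1 , s′ ⟩ , 0 ⟩ | residue-pr s′ =
  trans (eval-pairOf (proj zero) (numeral ⟨ 1 , 0 ⟩) refl refl) (⟪⟫≡⟨⟩ s _)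
eval-branches p c h eq restore s ((s′ , te) ∷ [])
  rewrite eval-residueᴾ ⟨ ⟨ 0 , s′ ⟩ , 0 ⟩ | residue-te s′ =
  trans (eval-pairOf zer zer refl refl) (⟪⟫≡⟨⟩ 0 0)

-- Ensures that `probe` outputs 0 in state 0 whatever `e` does.
ifOne-0 : ∀ k → ifOne k 0 ≡ 0
ifOne-0 zero          = refl
ifOne-0 (suc zero)    = refl
ifOne-0 (suc (suc _)) = refl

-- run yields 2 exactly when e has been found to take the value 1.
witness : Rec 1 → ℕ → ℕ → ℕ
witness e c s = ifOne (pred (run e s (c ∷ []))) s

-- The self-referential specification

module SelfReference (e : Rec 1) where

  -- The parameter is the code of the rule function.
  descriptionCodeᴾ output : PR 3
  descriptionCodeᴾ =
    pairOf (numeral (code isOperation))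
      (pairOf (numeral (code arityOf))
        (pairOf (numeral (code isNumber)) (pairOf (proj zero) zer)))
  output = comp ifOneᴾ
    (comp predᴾ (comp (compile e) (proj (suc zero) ∷ descriptionCodeᴾ ∷ []) ∷ []) ∷
     proj (suc zero) ∷ [])

  opaque
    selfReferentialRule : ∃ λ r → ∀ xs → eval r xs ≡ eval (ruleBody output) (code r ∷ xs)
    selfReferentialRule = recursionTheorem (ruleBody output)

  r : PR 3
  r = proj₁ selfReferentialRule

  d : Description
  d = record { isOp = isOperation ; ar = arityOf ; isState = isNumber ; rule = r }

  -- There is no circularity: `r` is fixed before `h`, and `eval-output` shows afterwards that
  -- `output`, given the code of `r`, computes `h`.
  h : ℕ → ℕ
  h = witness e (codeᵈ d)

  eval-output : ∀ s ls → eval output (code r ∷ s ∷ ls ∷ []) ≡ h s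
  eval-output s ls = begin
    eval output (code r ∷ s ∷ ls ∷ [])
      ≡⟨ eval-ifOneᴾ (eval predᴾ (w ∷ [])) s ⟩
    ifOne (eval predᴾ (w ∷ [])) s
      ≡⟨ cong (λ k → ifOne k s) (eval-predᴾ w) ⟩
    ifOne (pred w) s
      ≡⟨ cong (λ k → ifOne (pred k) s) (eval-compile e s (c ∷ [])) ⟩
    ifOne (pred (run e s (c ∷ []))) s
      ≡⟨ cong (λ k → ifOne (pred (run e s (k ∷ []))) s) c≡ ⟩
    h s ∎
    where
    open ≡-Reasoning
    c = eval descriptionCodeᴾ (code r ∷ s ∷ ls ∷ [])
    w = eval (compile e) (s ∷ c ∷ [])
    c≡ : c ≡ codeᵈ d
    c≡ = trans
      (eval-pairOf (numeral (code isOperation)) _ (eval-numeral (code isOperation))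
        (eval-pairOf (numeral (code arityOf)) _ (eval-numeral (code arityOf))
          (eval-pairOf (numeral (code isNumber)) _ (eval-numeral (code isNumber))
            (eval-pairOf (proj zero) zer refl refl))))
      (sym (codeᵈ-⟪⟫ d))

  eval-rule : ∀ f s ls → eval r (toℕ f ∷ s ∷ premissesCode ls ∷ [])
                           ≡ conclusionCode (probeSpecification h f s ls)
  eval-rule f s ls = begin
    eval r (toℕ f ∷ s ∷ l ∷ [])                            ≡⟨ proj₂ selfReferentialRule _ ⟩
    eval (cases (branches output)) (toℕ f ∷ code r ∷ s ∷ l ∷ [])
      ≡⟨ eval-cases (branches output) f _ ⟩
    eval (lookup (branches output) f) (code r ∷ s ∷ l ∷ [])
      ≡⟨ eval-branches output (code r) h eval-output f s ls ⟩
    conclusionCode (probeSpecification h f s ls)           ∎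
    where
    open ≡-Reasoning
    l = premissesCode ls

  selfReferential : PrimitiveRecursiveSpecification
  selfReferential = record
    { signature     = probeSignature
    ; State         = ℕ
    ; encOp         = operationCode
    ; encState      = stateCode
    ; specification = probeSpecification h
    ; description   = d
    ; describes     = record
      { isOp-correct    = isOperation-correct
      ; ar-correct      = arityOf-correct
      ; isState-correct = λ c → mk⇔ (λ _ → c , refl) (λ _ → refl)
      ; rule-correct    = eval-rule
      }
    }

-- The diagonal argument, for both semantics at once

module _ (P : ∀ {Sg : Signature} {S : Set} → Specification Sg S → Set)
  (compositional  : ∀ h → (∀ s → h s ≡ 0) → P (probeSpecification h))
  (¬compositional : ∀ h → h 0 ≡ 0 → ∀ s → h s ≢ 0 → ¬ P (probeSpecification h))
  where

  wrongAnswer : ∀ e c (P? : Dec (P (probeSpecification (witness e c)))) →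
                ¬ e [ c ∷ [] ]⇓ boolCode (does P?)
  wrongAnswer e c (yes p) e⇓1 =
    -- The state is both bound and output, so it must be at least `N` and nonzero; `N` itself may be
    -- 0.
    ¬compositional (witness e c) (ifOne-0 (pred (run e 0 (c ∷ [])))) (suc N) nonzero p
    where
    N = proj₁ (run-complete e⇓1)
    nonzero : witness e c (suc N) ≢ 0
    nonzero eq with trans (sym eq)
      (cong (λ w → ifOne (pred w) (suc N)) (proj₂ (run-complete e⇓1) (suc N) (n≤1+n N)))
    ... | ()
  wrongAnswer e c (no ¬p) e⇓0 = ¬p (compositional (witness e c) zeroes)
    where
    zeroes : ∀ s → witness e c s ≡ 0
    -- The bounded run yields 0 or 1, and `pred` maps both to 0, which `ifOne` rejects.
    zeroes s with run-sound e⇓0 s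
    ... | inj₁ eq = cong (λ w → ifOne (pred w) s) eq
    ... | inj₂ eq = cong (λ w → ifOne (pred w) s) eq

  -- Passing to the opaque code for an arbitrary `L` keeps the code of the concrete description from
  -- being unfolded.
  answer : ∀ {e} → e Decides P → (L : PrimitiveRecursiveSpecification) →
           Σ (Dec (P (specification L))) λ P? →
             e [ codeᵈ (description L) ∷ [] ]⇓ boolCode (does P?)
  answer decides L rewrite codeᵈ≡descriptionCode (description L) = decides L

  undecidable : Undecidable P
  -- The specification of `selfReferential` is built from `witness e` at its own code, which is
  -- where `e` is now asked.
  undecidable (e , decides) = wrongAnswer e (codeᵈ d) (proj₁ a) (proj₂ a)
    where
    open SelfReference e
    a = answer decides selfReferential

theorem4p12 : Undecidable TraceCompositional × Undecidable TerminationCompositional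
theorem4p12 =
  undecidable TraceCompositional traceCompositional ¬traceCompositional ,
  undecidable TerminationCompositional terminationCompositional ¬terminationCompositional
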